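{- Let $G=(V,E)$ be a directed graph such that $V$ has a partition $(A_1,\dots,A_k)$ into finitely many parts such that each $G[A_i]$ is hereditary in $\mathfrak{In}_1\text{ - }\mathfrak{Out}_1$ (for example, each $G[A_i]$ is isomorphic to $(\mathbb Z,<)$, to $(\mathbb N,<)$, to $(\mathbb N,>)$, or to a graph without edges). Then $G\in\mathfrak{In}_2\text{ - }\mathfrak{Out}_2$.
   Context: Digraphs $G=(V,E)$, $E\subseteq V\times V$, may be infinite. For $W\subseteq V$, $G[W]=(W,E\cap (W\times W))$ is the induced subgraph. A set $A\subseteq V$ is independent if there is no edge (in either direction) between two distinct elements of $A$. For $n\in\mathbb N$ and $A\subseteq V$, $\mathrm{Out}^G_n(A)$ (resp. $\mathrm{In}^G_n(A)$) is the set of all $v\in V$ such that there is a directed path of length at most $n$ from some point of $A$ to $v$ (resp. from $v$ to some point of $A$); length $0$ is allowed. $G\in\mathfrak{Out}_n$ (resp. $G\in\mathfrak{In}_n$) iff there is an independent $A\subseteq V$ with $V=\mathrm{Out}^G_n(A)$ (resp. $V=\mathrm{In}^G_n(A)$). $G\in\mathfrak{In}_n\text{ - }\mathfrak{Out}_k$ iff there is a partition $(V_1,V_2)$ of $V$ (parts may be empty) with $G[V_1]\in\mathfrak{In}_n$ and $G[V_2]\in\mathfrak{Out}_k$. $G$ is hereditary in a class iff all induced subgraphs of $G$ are in that class. $(\mathbb Z,<)$ denotes the digraph with vertex set $\mathbb Z$ in which $(x,y)$ is an edge iff $x<y$; similarly for $(\mathbb N,<)$ and $(\mathbb N,>)$.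 -}

module Defs where

open import Data.Fin.Base using (Fin)
open import Data.Integer.Base as ℤ using (ℤ)
open import Data.List.Base using (List; []; _∷_)
open import Data.List.Relation.Unary.Unique.Propositional using (Unique)
open import Data.Nat.Base as ℕ using (ℕ; zero; suc)
open import Data.Product.Base using (Σ; ∃; _×_; _,_; proj₁; proj₂)
open import Data.Unit.Base using (tt)
open import Function.Bundles using (_⇔_; Inverse)
open import Level using (Level; 0ℓ; _⊔_) renaming (suc to lsuc)
open import Relation.Binary.Bundles using (Setoid)
open import Relation.Binary.Core using (Rel)
import Relation.Binary.Construct.On as On
open import Relation.Binary.PropositionalEquality using (_≡_; _≢_; setoid)
open import Relation.Nullary.Negation using (¬_)
open import Relation.Unary using (Pred; _∈_; _⊆_; _≐_; _∪_; _⊥_; ⋃; U)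

private
  variable
    ℓ : Level

-- Vertex sets are subsets of an ambient type X, so that the vertices of an
-- induced subgraph are literally vertices of the original graph.
record Digraph {ℓ} (X : Set ℓ) : Set (lsuc ℓ) where
  field
    V     : Pred X ℓ
    E     : Rel X ℓ
    E⊆V×V : ∀ {x y} → E x y → x ∈ V × y ∈ V

open Digraph public

-- The induced subgraph; meaningful only for W ⊆ V G, which every use below ensures.
infix 10 _[_]
_[_] : {X : Set ℓ} → Digraph X → Pred X ℓ → Digraph X
G [ W ] = record
  { V     = W
  ; E     = λ x y → E G x y × (x ∈ W × y ∈ W)
  ; E⊆V×V = proj₂
  }

Independent : {X : Set ℓ} → Digraph X → Pred X ℓ → Set ℓ
Independent G A = ∀ {x y} → x ∈ A → y ∈ A → x ≢ y → ¬ E G x y × ¬ E G y x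

infixr 5 _∷_
data Walk {ℓ} {X : Set ℓ} (G : Digraph X) : ℕ → X → X → Set ℓ where
  trivial : ∀ {x} → x ∈ V G → Walk G 0 x x
  _∷_     : ∀ {n x y z} → E G x y → Walk G n y z → Walk G (suc n) x z

vertices : {X : Set ℓ} {G : Digraph X} {n : ℕ} {x y : X} → Walk G n x y → List X
vertices {x = x} (trivial _) = x ∷ []
vertices {x = x} (_ ∷ w)     = x ∷ vertices w

Path : {X : Set ℓ} → Digraph X → ℕ → X → X → Set ℓ
Path G n x y = Σ (Walk G n x y) λ w → Unique (vertices w)

Out : {X : Set ℓ} → ℕ → Digraph X → Pred X ℓ → Pred X ℓ
Out n G A v = v ∈ V G × ∃ λ a → a ∈ A × ∃ λ m → m ℕ.≤ n × Path G m a v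

In : {X : Set ℓ} → ℕ → Digraph X → Pred X ℓ → Pred X ℓ
In n G A v = v ∈ V G × ∃ λ a → a ∈ A × ∃ λ m → m ℕ.≤ n × Path G m v a

OutClass : {X : Set ℓ} → ℕ → Digraph X → Set (lsuc ℓ)
OutClass {ℓ} {X} n G =
  ∃ λ (A : Pred X ℓ) → A ⊆ V G × Independent G A × V G ≐ Out n G A

InClass : {X : Set ℓ} → ℕ → Digraph X → Set (lsuc ℓ)
InClass {ℓ} {X} n G =
  ∃ λ (A : Pred X ℓ) → A ⊆ V G × Independent G A × V G ≐ In n G A

InOutClass : {X : Set ℓ} → ℕ → ℕ → Digraph X → Set (lsuc ℓ)
InOutClass {ℓ} {X} n k G =
  ∃ λ (V₁ : Pred X ℓ) → ∃ λ (V₂ : Pred X ℓ) →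
    V G ≐ V₁ ∪ V₂ × V₁ ⊥ V₂ × InClass n (G [ V₁ ]) × OutClass k (G [ V₂ ])

Hereditary : {X : Set ℓ} → (Digraph X → Set (lsuc ℓ)) → Digraph X → Set (lsuc ℓ)
Hereditary {ℓ} {X} 𝒞 G = ∀ (W : Pred X ℓ) → W ⊆ V G → 𝒞 (G [ W ])

-- Parts may be empty.
IsPartition : {X : Set ℓ} {k : ℕ} → Pred X ℓ → (Fin k → Pred X ℓ) → Set ℓ
IsPartition {k = k} S A = S ≐ ⋃ (Fin k) A × (∀ {i j} → i ≢ j → A i ⊥ A j)

-- Vertices carry a membership proof, which is ignored when comparing them.
vertexSetoid : {X : Set ℓ} → Digraph X → Setoid ℓ ℓ
vertexSetoid {X = X} G = On.setoid {B = ∃ (V G)} (setoid X) proj₁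

infix 4 _≅_
record _≅_ {ℓ ℓ′} {X : Set ℓ} {Y : Set ℓ′} (G : Digraph X) (H : Digraph Y) : Set (ℓ ⊔ ℓ′) where
  field
    bijection : Inverse (vertexSetoid G) (vertexSetoid H)
  open Inverse bijection using (to)
  field
    edges : ∀ x y → E G (proj₁ x) (proj₁ y) ⇔ E H (proj₁ (to x)) (proj₁ (to y))

fromRel : {X : Set 0ℓ} → Rel X 0ℓ → Digraph X
fromRel R = record { V = U ; E = R ; E⊆V×V = λ _ → tt , tt }

⟨ℤ,<⟩ : Digraph ℤ
⟨ℤ,<⟩ = fromRel ℤ._<_

⟨ℕ,<⟩ : Digraph ℕ
⟨ℕ,<⟩ = fromRel ℕ._<_

⟨ℕ,>⟩ : Digraph ℕ
⟨ℕ,>⟩ = fromRel ℕ._>_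

Edgeless : {X : Set ℓ} → Digraph X → Set ℓ
Edgeless G = ∀ x y → ¬ E G x y

{-# OPTIONS --safe #-}

-- Extend the Chvátal–Lovász construction of quasi-kernels from vertices to sets,
-- by induction on the number of parts. Split the first part into B, absorbed in
-- one step by an independent S, and C, reached in one step from an independent T.
-- Remove every vertex within one step of S or from T; the rest W lies in the
-- remaining parts, so it splits with independent sets I and O. There is no edge
-- from W to S, so I together with those s ∈ S that have no edge into I is
-- independent; any other s is one step from I, and its in-neighbours are two
-- steps from I. The same holds for T and O with the edges reversed.

module Submission where

open import Defs
open import Axiom.ExcludedMiddle using (ExcludedMiddle)
open import Data.Empty using (⊥-elim)
open import Data.Empty.Polymorphic using () renaming (⊥ to ⊥ₚ)
open import Data.Fin.Base using (Fin; zero; suc)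
open import Data.Fin.Properties using (¬Fin0)
open import Data.Integer.Base as ℤ using (ℤ; +_)
import Data.Integer.Properties as ℤₚ
import Data.List.Membership.Propositional as List
open import Data.List.Relation.Unary.All.Properties using (¬Any⇒All¬)
open import Data.List.Relation.Unary.AllPairs using ([]; _∷_)
open import Data.List.Relation.Unary.All using ([])
open import Data.List.Relation.Unary.Any using (here; there)
open import Data.List.Relation.Unary.Unique.Propositional using (Unique)
open import Data.Nat.Base using (ℕ; zero; suc; _+_; _≤_; z≤n; s≤s)
import Data.Nat.Properties as ℕₚ
open import Data.Product.Base using (∃; _×_; _,_; proj₁; proj₂)
open import Data.Sum.Base using (_⊎_; inj₁; inj₂; [_,_]′)
open import Function.Base using (flip; _∘_; id)
open import Function.Bundles using (_⇔_; Inverse; Equivalence; mk⇔)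
open import Level using (Level)
open import Relation.Binary.Core using (Rel)
open import Relation.Binary.Definitions using (tri<; tri≈; tri>)
open import Relation.Binary.PropositionalEquality
  using (_≡_; _≢_; refl; sym; trans; cong; subst)
open import Relation.Nullary using (¬_; yes; no)
open import Relation.Unary using (Pred; _∈_; _∉_; _⊆_; _≐_; _∪_; _∩_; _⊥_; ⋃)

-- Bounded reachability, absorption and splits

private
  variable
    ℓ : Level
    X : Set ℓ
    R R′ : Rel X ℓ
    P Q K : Pred X ℓ
    l m n k : ℕ
    x y z v : X

-- Built on a bare relation, so that the Out side is the In side of `flip R`. Membership in `P` is
-- asked only of the vertices stepped to; that the start lies in `P` has to be supplied separately.
data Reach {ℓ} {X : Set ℓ} (R : Rel X ℓ) (P K : Pred X ℓ) : ℕ → Pred X ℓ where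
  here : ∀ {n v} → v ∈ K → Reach R P K n v
  step : ∀ {n v u} → R v u → u ∈ P → Reach R P K n u → Reach R P K (suc n) v

reach-≤ : m ≤ n → Reach R P K m v → Reach R P K n v
reach-≤ _         (here v∈K)     = here v∈K
reach-≤ (s≤s m≤n) (step r u∈P p) = step r u∈P (reach-≤ m≤n p)

reach-map : (∀ {x y} → x ∈ P → y ∈ P → R x y → R′ x y) → P ⊆ Q → v ∈ P →
            Reach R P K n v → Reach R′ Q K n v
reach-map f P⊆Q v∈P (here v∈K)     = here v∈K
reach-map f P⊆Q v∈P (step r u∈P p) = step (f v∈P u∈P r) (P⊆Q u∈P) (reach-map f P⊆Q u∈P p)

reach₁ : Reach R P K 1 v → v ∈ K ⊎ ∃ λ u → u ∈ K × R v u
reach₁ (here v∈K)            = inj₁ v∈K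
reach₁ (step r _ (here u∈K)) = inj₂ (_ , u∈K , r)

IndependentIn : {X : Set ℓ} → Rel X ℓ → Pred X ℓ → Set ℓ
IndependentIn R K = ∀ {x y} → x ∈ K → y ∈ K → x ≢ y → ¬ R x y

-- Absorbs (E G) n P and Absorbs (flip (E G)) n P say that G [ P ] is in 𝕴𝔫ₙ and
-- in 𝕺𝔲𝔱ₙ respectively.
Absorbs : {X : Set ℓ} → Rel X ℓ → ℕ → Pred X ℓ → Set _
Absorbs R n P = ∃ λ K → K ⊆ P × IndependentIn R K × P ⊆ Reach R P K n

Splits : {X : Set ℓ} → Rel X ℓ → ℕ → ℕ → Pred X ℓ → Set _
Splits R n k W = ∃ λ V₁ → ∃ λ V₂ →
  W ≐ V₁ ∪ V₂ × V₁ ⊥ V₂ × Absorbs R n V₁ × Absorbs (flip R) k V₂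

-- An edge of an induced subgraph carries membership proofs, so it lives in a different relation
-- than the edge of the whole graph. The two agree on `P`, and this moves between them.
absorbs-cong : (∀ {x y} → x ∈ P → y ∈ P → R x y ⇔ R′ x y) →
               Absorbs R n P → Absorbs R′ n P
absorbs-cong f (K , K⊆P , ind , reach) =
  K , K⊆P ,
  (λ x∈K y∈K x≢y r → ind x∈K y∈K x≢y (Equivalence.from (f (K⊆P x∈K) (K⊆P y∈K)) r)) ,
  (λ v∈P → reach-map (λ x∈P y∈P → Equivalence.to (f x∈P y∈P)) id v∈P (reach v∈P))

splits-cong : (∀ {x y} → x ∈ P → y ∈ P → R x y ⇔ R′ x y) →
              Splits R n k P → Splits R′ n k P
splits-cong f (V₁ , V₂ , (W⊆ , W⊇) , disj , abs₁ , abs₂) =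
  V₁ , V₂ , (W⊆ , W⊇) , disj ,
  absorbs-cong (λ p q → f (W⊇ (inj₁ p)) (W⊇ (inj₁ q))) abs₁ ,
  absorbs-cong (λ p q → f (W⊇ (inj₂ q)) (W⊇ (inj₂ p))) abs₂

absorbs-∅ : {R : Rel X ℓ} → Absorbs R n (λ _ → ⊥ₚ)
absorbs-∅ = (λ _ → ⊥ₚ) , id , (λ ()) , λ ()

-- Meant for chains: a greatest element absorbs everything below it, and a least element does the
-- same for the reversed relation.
absorbs-point : {R : Rel X ℓ} {P : Pred X ℓ} (a : X) → a ∈ P →
                (∀ {v} → v ∈ P → v ≡ a ⊎ R v a) → Absorbs R 1 P
absorbs-point {R = R} {P} a a∈P near =
  (_≡ a) , (λ { refl → a∈P }) ,
  (λ { refl refl x≢x → ⊥-elim (x≢x refl) }) , reach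
  where
  reach : P ⊆ Reach R P (_≡ a) 1
  reach v∈P with near v∈P
  ... | inj₁ v≡a = here v≡a
  ... | inj₂ r   = step r a∈P (here refl)

-- Translation between walks and bounded reachability

snoc : {G : Digraph X} → Walk G n x y → E G y z → Walk G (suc n) x z
snoc {G = G} (trivial _) e = e ∷ trivial (proj₂ (E⊆V×V G e))
snoc         (e′ ∷ w)    e = e′ ∷ snoc w e

module _ {X : Set ℓ} (H : Digraph X) {P : Pred X ℓ} where

  walk⇒reach : Walk (H [ P ]) m v x → x ∈ K → Reach (E H) P K m v
  walk⇒reach (trivial _)         x∈K = here x∈K
  walk⇒reach ((e , _ , u∈P) ∷ w) x∈K = step e u∈P (walk⇒reach w x∈K)

  -- List reversal with an accumulator: the walk is consumed from its start, and each edge, read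
  -- backwards, is put in front of the `Reach` of length `l` built so far.
  walk⇒reachᵒ : Walk (H [ P ]) m x v → Reach (flip (E H)) P K l x →
                Reach (flip (E H)) P K (m + l) v
  walk⇒reachᵒ (trivial _) p = p
  walk⇒reachᵒ {v = v} {K = K} {l = l} (_∷_ {n = m} (e , x∈P , _) w) p =
    subst (λ n → Reach (flip (E H)) P K n v) (ℕₚ.+-suc m l) (walk⇒reachᵒ w (step e x∈P p))

  reach⇒walk : v ∈ P → Reach (E H) P K n v →
               ∃ λ a → a ∈ K × ∃ λ m → m ≤ n × Walk (H [ P ]) m v a
  reach⇒walk v∈P (here v∈K)     = _ , v∈K , 0 , z≤n , trivial v∈P
  reach⇒walk v∈P (step e u∈P p) with reach⇒walk u∈P p
  ... | a , a∈K , m , m≤n , w = a , a∈K , suc m , s≤s m≤n , (e , v∈P , u∈P) ∷ w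

  reach⇒walkᵒ : v ∈ P → Reach (flip (E H)) P K n v →
                ∃ λ a → a ∈ K × ∃ λ m → m ≤ n × Walk (H [ P ]) m a v
  reach⇒walkᵒ v∈P (here v∈K)     = _ , v∈K , 0 , z≤n , trivial v∈P
  reach⇒walkᵒ v∈P (step e u∈P p) with reach⇒walkᵒ u∈P p
  ... | a , a∈K , m , m≤n , w = a , a∈K , suc m , s≤s m≤n , snoc w (e , u∈P , v∈P)

  inClass⇒absorbs : InClass n (H [ P ]) → Absorbs (E H) n P
  inClass⇒absorbs (K , K⊆P , ind , P⊆In , _) =
    K , K⊆P ,
    (λ x∈K y∈K x≢y e → proj₁ (ind x∈K y∈K x≢y) (e , K⊆P x∈K , K⊆P y∈K)) ,
    λ v∈P → let (_ , _ , a∈K , _ , m≤n , w , _) = P⊆In v∈P in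
      reach-≤ m≤n (walk⇒reach w a∈K)

  outClass⇒absorbs : OutClass n (H [ P ]) → Absorbs (flip (E H)) n P
  outClass⇒absorbs {n = n} (K , K⊆P , ind , P⊆Out , _) =
    K , K⊆P ,
    (λ x∈K y∈K x≢y e → proj₂ (ind x∈K y∈K x≢y) (e , K⊆P y∈K , K⊆P x∈K)) ,
    λ v∈P → let (_ , _ , a∈K , m , m≤n , w , _) = P⊆Out v∈P in
      reach-≤ (subst (_≤ n) (sym (ℕₚ.+-identityʳ m)) m≤n) (walk⇒reachᵒ w (here {n = 0} a∈K))

inOutClass⇒splits : (H : Digraph X) → InOutClass n k H → Splits (E H) n k (V H)
inOutClass⇒splits H (V₁ , V₂ , V≐ , disj , inC , outC) =
  V₁ , V₂ , V≐ , disj , inClass⇒absorbs H inC , outClass⇒absorbs H outC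

hereditary⇒splits : (G : Digraph X) → Hereditary (InOutClass n k) G →
                    ∀ W → W ⊆ V G → Splits (E G) n k W
hereditary⇒splits G her W W⊆V =
  splits-cong (λ x∈W y∈W → mk⇔ proj₁ (_, x∈W , y∈W))
    (inOutClass⇒splits (G [ W ]) (her W W⊆V))

-- Edgeless graphs and chains embedded in the integers

edgeless⇒splits : {R : Rel X ℓ} {W : Pred X ℓ} → (∀ x y → ¬ R x y) → Splits R 1 1 W
edgeless⇒splits {W = W} none =
  W , (λ _ → ⊥ₚ) , (inj₁ , λ { (inj₁ w∈W) → w∈W ; (inj₂ ()) }) , (λ ()) ,
  (W , id , (λ _ _ _ → none _ _) , here) , absorbs-∅

-- A common form for the three example orders. Values in `ℤ` later yield greatest elements, since a
-- nonempty set of integers bounded above has one.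
record ℤ-Ordered {ℓ} {X : Set ℓ} (G : Digraph X) : Set ℓ where
  field
    index     : ∃ (V G) → ℤ
    injective : ∀ {x y} → index x ≡ index y → proj₁ x ≡ proj₁ y
    edges     : ∀ x y → E G (proj₁ x) (proj₁ y) ⇔ index x ℤ.< index y

  ascending : ∀ {x y} → E G (proj₁ x) (proj₁ y) → index x ℤ.< index y
  ascending {x} {y} = Equivalence.to (edges x y)

  connex : ∀ (x y : ∃ (V G)) → E G (proj₁ x) (proj₁ y) ⊎ proj₁ x ≡ proj₁ y ⊎ E G (proj₁ y) (proj₁ x)
  connex x y with ℤₚ.<-cmp (index x) (index y)
  ... | tri< x<y _ _ = inj₁ (Equivalence.from (edges x y) x<y)
  ... | tri≈ _ x≡y _ = inj₂ (inj₁ (injective x≡y))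
  ... | tri> _ _ y<x = inj₂ (inj₂ (Equivalence.from (edges y x) y<x))

  asym : ∀ (x y : ∃ (V G)) → E G (proj₁ x) (proj₁ y) → ¬ E G (proj₁ y) (proj₁ x)
  asym x y e e′ = ℤₚ.<-asym (ascending {x} {y} e) (ascending {y} {x} e′)

≅⇒ℤ-ordered : {G : Digraph X} {Y : Set} {_<_ : Rel Y _} → G ≅ fromRel _<_ →
  (f : Y → ℤ) → (∀ {a b} → f a ≡ f b → a ≡ b) → (∀ {a b} → a < b ⇔ f a ℤ.< f b) →
  ℤ-Ordered G
≅⇒ℤ-ordered iso f f-inj f-mono = record
  { index     = f ∘ proj₁ ∘ to
  ; injective = λ {x} {y} eq →
      trans (sym (strictlyInverseʳ x)) (trans (from-cong (f-inj eq)) (strictlyInverseʳ y))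
  ; edges     = λ x y → mk⇔
      (Equivalence.to f-mono ∘ Equivalence.to (_≅_.edges iso x y))
      (Equivalence.from (_≅_.edges iso x y) ∘ Equivalence.from f-mono)
  }
  where open Inverse (_≅_.bijection iso)

-- Turns a gap in `ℤ` into a natural number, the fuel with which `greatest` starts.
i≤∣i-j∣+j : ∀ i j → i ℤ.≤ + ℤ.∣ i ℤ.- j ∣ ℤ.+ j
i≤∣i-j∣+j i j = begin
  i                        ≡⟨ ℤₚ.+-identityʳ i ⟨
  i ℤ.+ ℤ.0ℤ               ≡⟨ cong (λ k → i ℤ.+ k) (ℤₚ.+-inverseˡ j) ⟨
  i ℤ.+ (ℤ.- j ℤ.+ j)      ≡⟨ ℤₚ.+-assoc i (ℤ.- j) j ⟨
  i ℤ.- j ℤ.+ j            ≤⟨ ℤₚ.+-monoˡ-≤ j (i≤∣i∣ (i ℤ.- j)) ⟩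
  + ℤ.∣ i ℤ.- j ∣ ℤ.+ j    ∎
  where
  open ℤₚ.≤-Reasoning
  i≤∣i∣ : ∀ i → i ℤ.≤ + ℤ.∣ i ∣
  i≤∣i∣ (+ _)        = ℤₚ.≤-refl
  i≤∣i∣ ℤ.-[1+ _ ]   = ℤ.-≤+

-- From walks to paths, and from splits back to the classes

suffix : {G : Digraph X} (w : Walk G n y z) → Unique (vertices w) →
         x List.∈ vertices w → ∃ λ m → m ≤ n × Path G m x z
suffix (trivial p) u        (here refl) = 0 , z≤n , trivial p , u
suffix (e ∷ w)     u        (here refl) = _ , ℕₚ.≤-refl , e ∷ w , u
suffix (e ∷ w)     (_ ∷ u)  (there x∈w) with suffix w u x∈w
... | m , m≤n , p = m , ℕₚ.m≤n⇒m≤1+n m≤n , p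

module _ {ℓ} (em : ExcludedMiddle ℓ) {X : Set ℓ} where

  -- `In` and `Out` require distinct vertices, while unfolding `Reach` may revisit one. If the start
  -- recurs in the shortened tail, cutting the tail to its `suffix` from there removes the loop and
  -- adds no length.
  walk⇒path : {G : Digraph X} {x y : X} → Walk G n x y → ∃ λ m → m ≤ n × Path G m x y
  walk⇒path (trivial p) = 0 , z≤n , trivial p , [] ∷ []
  walk⇒path {x = x} (e ∷ w) with walk⇒path w
  ... | m , m≤n , w′ , u with em {P = x List.∈ vertices w′}
  ...   | no x∉w′ = suc m , s≤s m≤n , e ∷ w′ , ¬Any⇒All¬ _ x∉w′ ∷ u
  ...   | yes x∈w′ with suffix w′ u x∈w′
  ...     | l , l≤m , p = l , ℕₚ.m≤n⇒m≤1+n (ℕₚ.≤-trans l≤m m≤n) , p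

  absorbs⇒inClass : (H : Digraph X) → Absorbs (E H) n P → InClass n (H [ P ])
  absorbs⇒inClass H (K , K⊆P , ind , reach) =
    K , K⊆P ,
    (λ x∈K y∈K x≢y → ind x∈K y∈K x≢y ∘ proj₁ , ind y∈K x∈K (x≢y ∘ sym) ∘ proj₁) ,
    (λ v∈P → let (a , a∈K , _ , m≤n , w) = reach⇒walk H v∈P (reach v∈P)
                 (l , l≤m , p)           = walk⇒path w in
      v∈P , a , a∈K , l , ℕₚ.≤-trans l≤m m≤n , p) ,
    proj₁

  absorbs⇒outClass : (H : Digraph X) → Absorbs (flip (E H)) n P → OutClass n (H [ P ])
  absorbs⇒outClass H (K , K⊆P , ind , reach) =
    K , K⊆P ,
    (λ x∈K y∈K x≢y → ind y∈K x∈K (x≢y ∘ sym) ∘ proj₁ , ind x∈K y∈K x≢y ∘ proj₁) ,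
    (λ v∈P → let (a , a∈K , _ , m≤n , w) = reach⇒walkᵒ H v∈P (reach v∈P)
                 (l , l≤m , p)           = walk⇒path w in
      v∈P , a , a∈K , l , ℕₚ.≤-trans l≤m m≤n , p) ,
    proj₁

  splits⇒inOutClass : (H : Digraph X) → Splits (E H) n k (V H) → InOutClass n k H
  splits⇒inOutClass H (V₁ , V₂ , V≐ , disj , abs₁ , abs₂) =
    V₁ , V₂ , V≐ , disj , absorbs⇒inClass H abs₁ , absorbs⇒outClass H abs₂

  -- Induction on the number of parts

  absorbs-extend : {R : Rel X ℓ} {W N S : Pred X ℓ} → Absorbs R (2 + n) W →
    S ⊆ N → IndependentIn R S → (∀ {v} → v ∈ N → v ∈ S ⊎ ∃ λ s → s ∈ S × R v s) →
    (∀ {w s} → w ∈ W → s ∈ S → ¬ R w s) → Absorbs R (2 + n) (W ∪ N)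
  absorbs-extend {n = n} {R = R} {W} {N} {S} (I , I⊆W , indI , reachI) S⊆N indS near noEdge =
    J , [ inj₁ ∘ I⊆W , inj₂ ∘ S⊆N ∘ proj₁ ]′ , indJ , [ inW , inN ]′
    where
    Entering : Pred X ℓ
    Entering s = ∃ λ i → i ∈ I × R s i
    J : Pred X ℓ
    J = I ∪ λ s → s ∈ S × s ∉ Entering
    indJ : IndependentIn R J
    indJ (inj₁ x∈I)       (inj₁ y∈I)       x≢y = indI x∈I y∈I x≢y
    indJ (inj₁ x∈I)       (inj₂ (y∈S , _)) _   = noEdge (I⊆W x∈I) y∈S
    indJ (inj₂ (_ , x∉))  (inj₁ y∈I)       _ r = x∉ (_ , y∈I , r)
    indJ (inj₂ (x∈S , _)) (inj₂ (y∈S , _)) x≢y = indS x∈S y∈S x≢y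
    -- Old vertices keep their radius, so the bound does not grow with the number of parts.
    widen : ∀ {m v} → Reach R W I m v → Reach R (W ∪ N) J m v
    widen (here v∈I)     = here (inj₁ v∈I)
    widen (step r u∈W p) = step r (inj₁ u∈W) (widen p)
    fromS : ∀ {m s} → s ∈ S → Reach R (W ∪ N) J (suc m) s
    fromS {s = s} s∈S with em {P = s ∈ Entering}
    ... | yes (i , i∈I , r) = step r (inj₁ (I⊆W i∈I)) (here (inj₁ i∈I))
    ... | no s∉             = here (inj₂ (s∈S , s∉))
    inW : W ⊆ Reach R (W ∪ N) J (2 + n)
    inW v∈W = widen (reachI v∈W)
    inN : N ⊆ Reach R (W ∪ N) J (2 + n)
    inN v∈N with near v∈N
    ... | inj₁ v∈S           = fromS v∈S
    -- One step to `S` and at most one more into `I`: this is where the radius 2 comes from.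
    ... | inj₂ (s , s∈S , r) = step r (inj₂ (S⊆N s∈S)) (fromS s∈S)

  -- An arbitrary subset `W` of the union is allowed because the recursion runs on the remainder
  -- `W′`, which may miss vertices of the later parts.
  splits-⋃ : {R : Rel X ℓ} (k : ℕ) (A : Fin k → Pred X ℓ) →
    (∀ i (W : Pred X ℓ) → W ⊆ A i → Splits R 1 1 W) →
    (W : Pred X ℓ) → W ⊆ ⋃ (Fin k) A → Splits R 2 2 W
  splits-⋃ zero A her W W⊆⋃ =
    (λ _ → ⊥ₚ) , (λ _ → ⊥ₚ) ,
    ((λ w∈W → ⊥-elim (¬Fin0 (proj₁ (W⊆⋃ w∈W)))) , λ { (inj₁ ()) ; (inj₂ ()) }) ,
    (λ ()) , absorbs-∅ , absorbs-∅
  splits-⋃ {R = R} (suc k) A her W W⊆⋃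
    -- Heredity enters here: earlier rounds may have removed vertices of this part, so only what `W`
    -- retains of it is split.
    with B , C , (A⊆ , A⊇) , B⊥C , (S , S⊆B , indS , reachS) , (T , T⊆C , indT , reachT)
         ← her zero (W ∩ A zero) proj₂
    = W₁ ∪ N₁ , W₂ ∪ N₂ , (W⊆ , W⊇) , disj ,
      absorbs-extend abs₁ S⊆N₁ indS (proj₂ ∘ proj₂) W₁↛S ,
      absorbs-extend abs₂ T⊆N₂ indT (proj₂ ∘ proj₂) T↛W₂
    where
    ToS FromT N₁ N₂ W′ : Pred X ℓ
    ToS   v = v ∈ S ⊎ ∃ λ s → s ∈ S × R v s
    FromT v = v ∈ T ⊎ ∃ λ t → t ∈ T × R t v
    -- T must stay on the Out side; other vertices in both ToS and FromT go to the In side.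
    N₁ v = v ∈ W × v ∉ T × v ∈ ToS
    N₂ v = v ∈ W × v ∉ N₁ × v ∈ FromT
    W′ v = v ∈ W × v ∉ N₁ × v ∉ N₂
    S∩T=∅ : ∀ {v} → v ∈ S → v ∉ T
    S∩T=∅ v∈S v∈T = B⊥C (S⊆B v∈S , T⊆C v∈T)
    S⊆N₁ : S ⊆ N₁
    S⊆N₁ v∈S = proj₁ (A⊇ (inj₁ (S⊆B v∈S))) , S∩T=∅ v∈S , inj₁ v∈S
    T⊆N₂ : T ⊆ N₂
    T⊆N₂ v∈T = proj₁ (A⊇ (inj₂ (T⊆C v∈T))) , (λ (_ , v∉T , _) → v∉T v∈T) , inj₁ v∈T
    -- `N₁` leaves out `T`, but `T` lies in `N₂`. A vertex outside both is thus not in `T`, and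
    -- being in `ToS` would put it into `N₁`.
    ToS∩W′=∅ : ∀ {v} → v ∈ W′ → v ∉ ToS
    ToS∩W′=∅ (v∈W , v∉N₁ , v∉N₂) near = v∉N₁ (v∈W , v∉N₂ ∘ T⊆N₂ , near)
    FromT∩W′=∅ : ∀ {v} → v ∈ W′ → v ∉ FromT
    FromT∩W′=∅ (v∈W , v∉N₁ , v∉N₂) near = v∉N₂ (v∈W , v∉N₁ , near)
    -- Radius 1 puts every vertex of `B` in `ToS` and every vertex of `C` in `FromT`. Hence the
    -- remainder is covered by one part fewer.
    W′∩A₀=∅ : ∀ {v} → v ∈ W′ → v ∉ A zero
    W′∩A₀=∅ v∈W′ v∈A with A⊆ (proj₁ v∈W′ , v∈A)
    ... | inj₁ v∈B = ToS∩W′=∅ v∈W′ (reach₁ (reachS v∈B))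
    ... | inj₂ v∈C = FromT∩W′=∅ v∈W′ (reach₁ (reachT v∈C))
    W′⊆⋃ : W′ ⊆ ⋃ (Fin k) (A ∘ suc)
    W′⊆⋃ v∈W′ with W⊆⋃ (proj₁ v∈W′)
    ... | zero  , v∈A = ⊥-elim (W′∩A₀=∅ v∈W′ v∈A)
    ... | suc i , v∈A = i , v∈A
    rest : Splits R 2 2 W′
    rest = splits-⋃ k (A ∘ suc) (her ∘ suc) W′ W′⊆⋃
    W₁ W₂ : Pred X ℓ
    W₁ = proj₁ rest
    W₂ = proj₁ (proj₂ rest)
    W′≐ : W′ ≐ W₁ ∪ W₂
    W′≐ = proj₁ (proj₂ (proj₂ rest))
    W₁⊥W₂ : W₁ ⊥ W₂
    W₁⊥W₂ = proj₁ (proj₂ (proj₂ (proj₂ rest)))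
    abs₁ : Absorbs R 2 W₁
    abs₁ = proj₁ (proj₂ (proj₂ (proj₂ (proj₂ rest))))
    abs₂ : Absorbs (flip R) 2 W₂
    abs₂ = proj₂ (proj₂ (proj₂ (proj₂ (proj₂ rest))))
    W₁⊆W′ : W₁ ⊆ W′
    W₁⊆W′ = proj₂ W′≐ ∘ inj₁
    W₂⊆W′ : W₂ ⊆ W′
    W₂⊆W′ = proj₂ W′≐ ∘ inj₂
    W₁↛S : ∀ {w s} → w ∈ W₁ → s ∈ S → ¬ R w s
    W₁↛S w∈W₁ s∈S r = ToS∩W′=∅ (W₁⊆W′ w∈W₁) (inj₂ (_ , s∈S , r))
    T↛W₂ : ∀ {w t} → w ∈ W₂ → t ∈ T → ¬ R t w
    T↛W₂ w∈W₂ t∈T r = FromT∩W′=∅ (W₂⊆W′ w∈W₂) (inj₂ (_ , t∈T , r))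
    W⊆ : W ⊆ (W₁ ∪ N₁) ∪ (W₂ ∪ N₂)
    W⊆ {v} v∈W with em {P = v ∈ N₁} | em {P = v ∈ N₂}
    ... | yes v∈N₁ | _        = inj₁ (inj₂ v∈N₁)
    ... | no _     | yes v∈N₂ = inj₂ (inj₂ v∈N₂)
    ... | no v∉N₁  | no v∉N₂  with proj₁ W′≐ (v∈W , v∉N₁ , v∉N₂)
    ...   | inj₁ v∈W₁ = inj₁ (inj₁ v∈W₁)
    ...   | inj₂ v∈W₂ = inj₂ (inj₁ v∈W₂)
    W⊇ : (W₁ ∪ N₁) ∪ (W₂ ∪ N₂) ⊆ W
    W⊇ = [ [ proj₁ ∘ W₁⊆W′ , proj₁ ]′ , [ proj₁ ∘ W₂⊆W′ , proj₁ ]′ ]′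
    disj : (W₁ ∪ N₁) ⊥ (W₂ ∪ N₂)
    disj (inj₁ v∈W₁ , inj₁ v∈W₂)       = W₁⊥W₂ (v∈W₁ , v∈W₂)
    disj (inj₁ v∈W₁ , inj₂ v∈N₂)       = proj₂ (proj₂ (W₁⊆W′ v∈W₁)) v∈N₂
    disj (inj₂ v∈N₁ , inj₁ v∈W₂)       = proj₁ (proj₂ (W₂⊆W′ v∈W₂)) v∈N₁
    disj (inj₂ v∈N₁ , inj₂ (_ , v∉N₁ , _)) = v∉N₁ v∈N₁

  -- A nonempty W splits at any w₀ ∈ W: w₀ is the least element of its upper half,
  -- and the lower half is empty or, being bounded above in ℤ, has a greatest element.
  ℤ-ordered⇒splits : {G : Digraph X} → ℤ-Ordered G →
                     (W : Pred X ℓ) → W ⊆ V G → Splits (E G) 1 1 W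
  ℤ-ordered⇒splits {G = G} ord W W⊆V with em {P = ∃ W}
  ... | no W=∅ = (λ _ → ⊥ₚ) , (λ _ → ⊥ₚ) ,
                 ((λ w∈W → ⊥-elim (W=∅ (_ , w∈W))) , λ { (inj₁ ()) ; (inj₂ ()) }) ,
                 (λ ()) , absorbs-∅ , absorbs-∅
  ... | yes (w₀ , w₀∈W) =
    Below , Above , (W⊆ , [ proj₁ , proj₁ ]′) , disj , belowAbs ,
    absorbs-point w₀ (w₀∈W , inj₁ refl) proj₂
    where
    open ℤ-Ordered ord
    Below Above : Pred X ℓ
    Below v = v ∈ W × E G v w₀
    Above v = v ∈ W × (v ≡ w₀ ⊎ E G w₀ v)
    index₀ : ℤ
    index₀ = index (w₀ , W⊆V w₀∈W)
    indexW : ∀ {v} → v ∈ W → ℤ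
    indexW v∈W = index (_ , W⊆V v∈W)
    W⊆ : W ⊆ Below ∪ Above
    W⊆ v∈W with connex (_ , W⊆V v∈W) (w₀ , W⊆V w₀∈W)
    ... | inj₁ v→w₀        = inj₁ (v∈W , v→w₀)
    ... | inj₂ (inj₁ v≡w₀) = inj₂ (v∈W , inj₁ v≡w₀)
    ... | inj₂ (inj₂ w₀→v) = inj₂ (v∈W , inj₂ w₀→v)
    disj : Below ⊥ Above
    disj ((v∈W , v→w₀) , _ , inj₁ refl) =
      asym (_ , W⊆V v∈W) (_ , W⊆V v∈W) v→w₀ v→w₀
    disj ((v∈W , v→w₀) , _ , inj₂ w₀→v) =
      asym (_ , W⊆V v∈W) (w₀ , W⊆V w₀∈W) v→w₀ w₀→v
    -- `n` bounds how far the index of `v` lies below `index₀`. Moving along an edge inside `Below`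
    -- raises the index by at least one, which pays for the decrease of `n`.
    greatest : ∀ n {v} (b : v ∈ Below) → index₀ ℤ.≤ + n ℤ.+ indexW (proj₁ b) →
               ∃ λ a → a ∈ Below × (∀ {u} → u ∈ Below → u ≡ a ⊎ E G u a)
    -- With no fuel left, `index₀` is at most the index of `v`, against the edge from `v` to `w₀`.
    greatest zero {v} (v∈W , v→w₀) bound =
      ⊥-elim (ℤₚ.<⇒≱ (ascending {_ , W⊆V v∈W} {w₀ , W⊆V w₀∈W} v→w₀)
                     (subst (index₀ ℤ.≤_) (ℤₚ.+-identityˡ _) bound))
    greatest (suc n) {v} b@(v∈W , _) bound with em {P = ∃ λ u → u ∈ Below × E G v u}
    ... | yes (u , b′@(u∈W , _) , v→u) = greatest n b′ (begin
      index₀                            ≤⟨ bound ⟩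
      + suc n ℤ.+ indexW v∈W            ≡⟨ cong (ℤ._+ indexW v∈W) (ℤₚ.+-comm (+ 1) (+ n)) ⟩
      + n ℤ.+ + 1 ℤ.+ indexW v∈W        ≡⟨ ℤₚ.+-assoc (+ n) (+ 1) (indexW v∈W) ⟩
      + n ℤ.+ ℤ.suc (indexW v∈W)        ≤⟨ ℤₚ.+-monoʳ-≤ (+ n) (ℤₚ.i<j⇒suc[i]≤j v<u) ⟩
      + n ℤ.+ indexW u∈W                ∎)
      where
      open ℤₚ.≤-Reasoning
      v<u : indexW v∈W ℤ.< indexW u∈W
      v<u = ascending {_ , W⊆V v∈W} {_ , W⊆V u∈W} v→u
    -- By `connex`, a vertex with no edge into `Below` receives an edge from every other vertex of
    -- `Below`.
    ... | no maximal = v , b , below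
      where
      below : ∀ {u} → u ∈ Below → u ≡ v ⊎ E G u v
      below {u} b′@(u∈W , _) with connex (u , W⊆V u∈W) (v , W⊆V v∈W)
      ... | inj₁ u→v        = inj₂ u→v
      ... | inj₂ (inj₁ u≡v) = inj₁ u≡v
      ... | inj₂ (inj₂ v→u) = ⊥-elim (maximal (u , b′ , v→u))
    belowAbs : Absorbs (E G) 1 Below
    belowAbs with em {P = ∃ Below}
    ... | no none     = (λ _ → ⊥ₚ) , (λ ()) , (λ ()) , λ b → ⊥-elim (none (_ , b))
    ... | yes (v , b) with greatest _ b (i≤∣i-j∣+j index₀ (indexW (proj₁ b)))
    ...   | a , a∈Below , top = absorbs-point a a∈Below top

  -- Assembly: the partition theorem and the example graphs

  splits⇒hereditary : (G : Digraph X) → (∀ W → W ⊆ V G → Splits (E G) n k W) →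
                      Hereditary (InOutClass n k) G
  splits⇒hereditary G split W W⊆V =
    splits⇒inOutClass (G [ W ])
      (splits-cong (λ x∈W y∈W → mk⇔ (_, x∈W , y∈W) proj₁) (split W W⊆V))

corollary2p6 : ∀ {ℓ : Level} → ExcludedMiddle ℓ →
    ∀ {X : Set ℓ} (G : Digraph X) (k : ℕ) (A : Fin k → Pred X ℓ) →
    IsPartition (V G) A →
    ((∀ i → Hereditary (InOutClass 1 1) (G [ A i ])) → InOutClass 2 2 G)
    × (∀ i → (G [ A i ] ≅ ⟨ℤ,<⟩) ⊎ (G [ A i ] ≅ ⟨ℕ,<⟩) ⊎ (G [ A i ] ≅ ⟨ℕ,>⟩) ⊎ Edgeless (G [ A i ]) →
    Hereditary (InOutClass 1 1) (G [ A i ]))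
corollary2p6 {ℓ} em {X} G k A ((V⊆⋃ , _) , _) = split , examples
  where
  split : (∀ i → Hereditary (InOutClass 1 1) (G [ A i ])) → InOutClass 2 2 G
  split her = splits⇒inOutClass em G (splits-⋃ em k A parts (V G) V⊆⋃)
    where
    parts : ∀ i (W : Pred X ℓ) → W ⊆ A i → Splits (E G) 1 1 W
    parts i W W⊆A =
      splits-cong (λ x∈W y∈W → mk⇔ proj₁ (_, W⊆A x∈W , W⊆A y∈W))
        (hereditary⇒splits (G [ A i ]) (her i) W W⊆A)
  fromOrder : ∀ i → ℤ-Ordered (G [ A i ]) → Hereditary (InOutClass 1 1) (G [ A i ])
  fromOrder i ord = splits⇒hereditary em (G [ A i ]) (ℤ-ordered⇒splits em ord)
  examples : ∀ i → (G [ A i ] ≅ ⟨ℤ,<⟩) ⊎ (G [ A i ] ≅ ⟨ℕ,<⟩) ⊎ (G [ A i ] ≅ ⟨ℕ,>⟩) ⊎ Edgeless (G [ A i ]) →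
             Hereditary (InOutClass 1 1) (G [ A i ])
  examples i (inj₁ iso) =
    fromOrder i (≅⇒ℤ-ordered iso id id (mk⇔ id id))
  examples i (inj₂ (inj₁ iso)) =
    fromOrder i (≅⇒ℤ-ordered iso +_ ℤₚ.+-injective (mk⇔ ℤ.+<+ ℤₚ.drop‿+<+))
  examples i (inj₂ (inj₂ (inj₁ iso))) =
    -- Negation reverses the order, so `>` on `ℕ` becomes `<` on the nonpositive integers.
    fromOrder i (≅⇒ℤ-ordered iso (ℤ.-_ ∘ +_) (ℤₚ.+-injective ∘ ℤₚ.neg-injective)
      (mk⇔ (ℤₚ.neg-mono-< ∘ ℤ.+<+) (ℤₚ.drop‿+<+ ∘ ℤₚ.neg-cancel-<)))
  examples i (inj₂ (inj₂ (inj₂ none))) =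
    splits⇒hereditary em (G [ A i ]) λ _ _ → edgeless⇒splits none
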